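{- Let $\lambda, m, t$ be given positive integers. Then $\mu(\lambda,m;t)\ge n-1$ and $2\lambda\ge (t+1)n$ are necessary conditions for the existence of a $(t+1)$-color connected colored edge graph $G(V,E,C,f)$ with $|V|=n$, $|E|=\lambda$ and $|C|=m$.
   Context: A colored edge graph is a tuple $G(V,E,C,f)$ with $V$ the node set, $E$ the edge set, $C$ the color set, and $f$ a map from $E$ onto $C$; multiple edges between two nodes are not allowed. For $t\ge 1$, two distinct nodes $A,B\in V$ are called $(t+1)$-color connected if for any color set $C_t\subseteq C$ of size $t$ there is a path from $A$ to $B$ in $G$ whose edges do not contain any color in $C_t$. The colored edge graph $G$ is $(t+1)$-color connected if and only if any two nodes $A$ and $B$ of $G$ are $(t+1)$-color connected. A $(\lambda,m)$-partition is a pair $(X,\mathcal{F})$ where $X$ is a finite set with $|X|=\lambda$ and $\mathcal{F}$ is a set of mutually disjoint subsets of $X$ with $|\mathcal{F}|=m$ and $X=\bigcup_{P\in\mathcal{F}}P$. For such a pair and a positive integer $t$, put $\mu(X,\mathcal{F};t)=\min\{|X\setminus(\bigcup_{i=1}^{t}B_i)| : B_1,\ldots,B_t\in\mathcal{F}\}$. For positive integers $\lambda,m,t$, put $\mu(\lambda,m;t)=\max\{\mu(X,\mathcal{F};t): (X,\mathcal{F})\text{ is a }(\lambda,m)\text{ -partition}\}$.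
   Formalization: The condition t ≤ m is added: for t > m there are no color sets of size t, so every graph is vacuously (t+1)-color connected and the claim fails (a single edge with n=2, λ=m=1, t=2 gives 2λ=2 < 6). -}

module Defs where

open import Data.Bool.Base using (true; false)
open import Data.Bool.Properties using () renaming (_≟_ to _≟ᵇ_)
open import Data.Fin.Base using (Fin)
open import Data.Fin.Subset using (Subset; _∉_; _∩_; ∁; ⋃; ⊤; ⊥; ∣_∣)
open import Data.List.Base as List using (List; []; _∷_)
open import Data.List.Extrema.Nat using (min; max)
open import Data.List.Relation.Unary.All using (All)
open import Data.List.Relation.Unary.Unique.Propositional using (Unique)
open import Data.Nat.Base using (ℕ; zero; suc)
open import Data.Product.Base using (_×_; _,_; Σ-syntax)
open import Data.Sum.Base using (_⊎_)
open import Data.Vec.Base as Vec using (Vec; []; _∷_; toList)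
open import Data.Vec.Properties using (≡-dec)
open import Data.Vec.Relation.Unary.AllPairs using (AllPairs; allPairs?)
open import Function.Definitions using (Surjective)
open import Relation.Binary.Definitions using (DecidableEquality)
open import Relation.Binary.PropositionalEquality using (_≡_; _≢_)
open import Relation.Nullary.Decidable using (Dec; ¬?; _×-dec_)

-- A finite set with k elements is represented by Fin k throughout.

-- Undirected graphs with n nodes, ℓ edges and m colors.  The orientation
-- of the pair `ends e` carries no meaning: only `Joins` is ever used.
record ColoredEdgeGraph (n ℓ m : ℕ) : Set where
  field
    ends : Fin ℓ → Fin n × Fin n

  Joins : Fin ℓ → Fin n → Fin n → Set
  Joins e u v = ends e ≡ (u , v) ⊎ ends e ≡ (v , u)

  field
    loopless      : ∀ {e u v} → Joins e u v → u ≢ v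
    noMultiEdges  : ∀ {e e′ u v} → Joins e u v → Joins e′ u v → e ≡ e′
    color         : Fin ℓ → Fin m
    colorOnto     : Surjective _≡_ _≡_ color

  data Walk : Fin n → Fin n → Set where
    stop : ∀ {u} → Walk u u
    step : ∀ {u v w} (e : Fin ℓ) → Joins e u v → Walk v w → Walk u w

  nodes : ∀ {u v} → Walk u v → List (Fin n)
  nodes {u} stop         = u ∷ []
  nodes {u} (step _ _ p) = u ∷ nodes p

  edges : ∀ {u v} → Walk u v → List (Fin ℓ)
  edges stop         = []
  edges (step e _ p) = e ∷ edges p

  Path : Fin n → Fin n → Set
  Path u v = Σ[ p ∈ Walk u v ] Unique (nodes p)

  Avoids : ∀ {u v} → Subset m → Path u v → Set
  Avoids S (p , _) = All (λ e → color e ∉ S) (edges p)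

open ColoredEdgeGraph using (Path; Avoids)

-- `Connected₊₁ t` is (t+1)-color connectedness: the argument is the number
-- t of colors removed.  There is no color set of size t when t exceeds the
-- number m of colors, so both notions then hold vacuously.
NodesConnected₊₁ : ∀ {n ℓ m} → ℕ → ColoredEdgeGraph n ℓ m → Fin n → Fin n → Set
NodesConnected₊₁ {m = m} t G A B =
  (S : Subset m) → ∣ S ∣ ≡ t → Σ[ p ∈ Path G A B ] Avoids G S p

Connected₊₁ : ∀ {n ℓ m} → ℕ → ColoredEdgeGraph n ℓ m → Set
Connected₊₁ t G = ∀ A B → A ≢ B → NodesConnected₊₁ t G A B

-- Partitions of X = Fin ℓ.  The set 𝓕 of m subsets is listed without
-- repetition, in some order.  As disjointness does not exclude it, one
-- member may be empty.
IsPartition : ∀ {ℓ m} → Vec (Subset ℓ) m → Set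
IsPartition 𝓕 =
    AllPairs (λ P Q → P ≢ Q) 𝓕
  × AllPairs (λ P Q → P ∩ Q ≡ ⊥) 𝓕
  × ⋃ (toList 𝓕) ≡ ⊤

_≟ˢ_ : ∀ {ℓ} → DecidableEquality (Subset ℓ)
_≟ˢ_ = ≡-dec _≟ᵇ_

isPartition? : ∀ {ℓ m} (𝓕 : Vec (Subset ℓ) m) → Dec (IsPartition 𝓕)
isPartition? 𝓕 =
        allPairs? (λ P Q → ¬? (P ≟ˢ Q)) 𝓕
  ×-dec allPairs? (λ P Q → (P ∩ Q) ≟ˢ ⊥) 𝓕
  ×-dec (⋃ (toList 𝓕) ≟ˢ ⊤)

-- All k-tuples of members of xs, repetitions allowed.
tuples : ∀ {A : Set} → List A → (k : ℕ) → List (Vec A k)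
tuples xs zero    = [] ∷ []
tuples xs (suc k) = List.cartesianProductWith _∷_ xs (tuples xs k)

subsets : (ℓ : ℕ) → List (Subset ℓ)
subsets = tuples (true ∷ false ∷ [])

partitions : (ℓ m : ℕ) → List (Vec (Subset ℓ) m)
partitions ℓ m = List.filter isPartition? (tuples (subsets ℓ) m)

-- μ(X,𝓕;t).  No value exceeds ℓ = |X|, so starting `min` from ℓ does not
-- affect the minimum as soon as 𝓕 is nonempty.
μᶠ : ∀ {ℓ m} → Vec (Subset ℓ) m → ℕ → ℕ
μᶠ {ℓ} 𝓕 t =
  min ℓ (List.map (λ B → ∣ ∁ (⋃ (toList B)) ∣) (tuples (toList 𝓕) t))

-- μ(ℓ,m;t).  Starting `max` from 0 does not affect the maximum as soon as
-- an (ℓ,m)-partition exists; otherwise the value is 0.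
μ : (ℓ m t : ℕ) → ℕ
μ ℓ m t = max 0 (List.map (λ 𝓕 → μᶠ 𝓕 t) (partitions ℓ m))

{-# OPTIONS --safe #-}
-- For the first inequality, take as partition the color classes.  Deleting t
-- of them, possibly repeated, leaves a connected graph, and identifying the two
-- ends of an edge lowers the number of nodes by at most one, so at least n − 1
-- edges remain.
--
-- For the second, if at most t edges at a node are known, deleting their
-- colors still leaves a path to another node; its first edge is a new edge at
-- the node.  So every degree is at least t + 1, while there are 2ℓ half-edges.
module Submission where

open import Defs
open import Data.Nat.Base using (ℕ; _+_; _*_; _∸_; _≤_; _≥_; NonZero)
open import Data.Product.Base using (_×_; Σ-syntax)

open import Data.Bool.Base using (true; false)
open import Data.Fin.Base using (Fin; zero; suc; punchIn; punchOut; combine; remQuot)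
open import Data.Fin.Properties using (_≟_; punchInᵢ≢i; punchOut-cong; punchOut-punchIn; injective⇒≤; combine-injective; combine-remQuot)
open import Data.Fin.Subset using (Subset; _∈_; _∉_; _⊆_; _∪_; ∁; ⁅_⁆; ⋃; ⊤; ⊥; ∣_∣; inside; outside)
open import Data.Fin.Subset.Properties using (∉⊥; ∈⊤; ⊆⊤; ⊥⊆; ⊆-antisym; x∈⁅x⁆; ∣⁅x⁆∣≡1; ∣⊥∣≡0; ∣⊤∣≡n; ∣p∣≤n; x∈p∩q⁻; x∈p∪q⁻; x∈p∪q⁺; x∉p⇒x∈∁p; out⊆; in⊆in)
open import Data.List.Base using (List)
open import Data.List.Extrema.Nat using (v≤min⁺; v≤max⁺)
open import Data.List.Membership.Propositional as List using (lose)
open import Data.List.Membership.Propositional.Properties using (∈-cartesianProductWith⁺; ∈-cartesianProductWith⁻; ∈-filter⁺)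
import Data.List.Relation.Unary.All as ListAll
import Data.List.Relation.Unary.All.Properties as ListAll
open import Data.List.Relation.Unary.Any using (here; there)
import Data.List.Relation.Unary.Any.Properties as ListAny
open import Data.Nat.Base using (zero; suc; z≤n; s≤s; s≤s⁻¹)
open import Data.Nat.Properties using (≤-refl; ≤-reflexive; ≤-trans; n≤1+n; +-suc; +-comm; +-mono-≤; +-monoʳ-≤; m≤n+o⇒m∸n≤o; m≤n⇒m<n∨m≡n)
open import Data.Product.Base using (_,_; proj₁; proj₂; ∃-syntax; uncurry)
open import Data.Sum.Base using (inj₁; inj₂)
open import Data.Vec.Base using (Vec; []; _∷_; here; there; toList; tabulate; lookup)
open import Data.Vec.Membership.Propositional using () renaming (_∈_ to _∈ᵛ_)
open import Data.Vec.Membership.Propositional.Properties using (∈-toList⁺; ∈-toList⁻; ∈-tabulate⁺)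
open import Data.Vec.Properties using (lookup∘tabulate; lookup⇒[]=; []=⇒lookup)
open import Data.Vec.Relation.Unary.All as VecAll using (All; []; _∷_)
import Data.Vec.Relation.Unary.All.Properties as VecAll
import Data.Vec.Relation.Unary.AllPairs.Properties as AllPairs
import Data.Vec.Relation.Unary.Any.Properties as VecAny
open import Function.Base using (_∘_; id)
open import Function.Definitions using (Injective; StrictlySurjective)
open import Relation.Binary.PropositionalEquality using (_≡_; _≢_; refl; sym; trans; cong; cong₂; subst)
open import Relation.Nullary using (yes; no; does; contradiction)
open import Relation.Nullary.Decidable using (dec-true)

-- Color sets of prescribed size.

∣p∪q∣≤∣p∣+∣q∣ : ∀ {n} (p q : Subset n) → ∣ p ∪ q ∣ ≤ ∣ p ∣ + ∣ q ∣
∣p∪q∣≤∣p∣+∣q∣ []            []            = z≤n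
∣p∪q∣≤∣p∣+∣q∣ (outside ∷ p) (outside ∷ q) = ∣p∪q∣≤∣p∣+∣q∣ p q
∣p∪q∣≤∣p∣+∣q∣ (outside ∷ p) (inside ∷ q)  =
  ≤-trans (s≤s (∣p∪q∣≤∣p∣+∣q∣ p q)) (≤-reflexive (sym (+-suc ∣ p ∣ ∣ q ∣)))
∣p∪q∣≤∣p∣+∣q∣ (inside ∷ p)  (outside ∷ q) = s≤s (∣p∪q∣≤∣p∣+∣q∣ p q)
∣p∪q∣≤∣p∣+∣q∣ (inside ∷ p)  (inside ∷ q)  =
  s≤s (≤-trans (∣p∪q∣≤∣p∣+∣q∣ p q) (+-monoʳ-≤ ∣ p ∣ (n≤1+n _)))

-- Connectedness only speaks of color sets with exactly `t` elements, so smaller sets have to be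
-- padded.
enlarge : ∀ {m t} (p : Subset m) → ∣ p ∣ ≤ t → t ≤ m → ∃[ q ] p ⊆ q × ∣ q ∣ ≡ t
enlarge [] _ z≤n = [] , id , refl
enlarge (inside ∷ p) (s≤s ∣p∣≤t) (s≤s t≤m) =
  let q , p⊆q , ∣q∣≡t = enlarge p ∣p∣≤t t≤m
  in inside ∷ q , in⊆in p⊆q , cong suc ∣q∣≡t
enlarge {suc m} (outside ∷ p) ∣p∣≤t t≤1+m with m≤n⇒m<n∨m≡n t≤1+m
-- Here `t` is the size of the whole set, so the head cannot stay outside.
... | inj₂ refl = ⊤ , ⊆⊤ , ∣⊤∣≡n (suc m)
... | inj₁ t<1+m =
  let q , p⊆q , ∣q∣≡t = enlarge p ∣p∣≤t (s≤s⁻¹ t<1+m)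
  in outside ∷ q , out⊆ p⊆q , ∣q∣≡t

image : ∀ {k m} (c : Fin k → Fin m) → ∃[ p ] (∀ i → c i ∈ p) × ∣ p ∣ ≤ k
image {zero}  {m} c = ⊥ , (λ ()) , ≤-reflexive (∣⊥∣≡0 m)
image {suc k} c =
  let p , c∈p , ∣p∣≤k = image (c ∘ suc)
  in ⁅ c zero ⁆ ∪ p
   , (λ { zero → x∈p∪q⁺ (inj₁ (x∈⁅x⁆ _)) ; (suc i) → x∈p∪q⁺ (inj₂ (c∈p i)) })
   , ≤-trans (∣p∪q∣≤∣p∣+∣q∣ ⁅ c zero ⁆ p)
             (+-mono-≤ (≤-reflexive (∣⁅x⁆∣≡1 (c zero))) ∣p∣≤k)

cover : ∀ {k m t} (c : Fin k → Fin m) → k ≤ t → t ≤ m →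
        ∃[ S ] ∣ S ∣ ≡ t × (∀ i → c i ∈ S)
cover c k≤t t≤m =
  let p , c∈p , ∣p∣≤k = image c
      S , p⊆S , ∣S∣≡t = enlarge p (≤-trans ∣p∣≤k k≤t) t≤m
  in S , ∣S∣≡t , p⊆S ∘ c∈p

-- Unions, enumerations and bounds on μ.

∈-⋃⁺ : ∀ {n} {x : Fin n} {p ps} → p List.∈ ps → x ∈ p → x ∈ ⋃ ps
∈-⋃⁺ (here refl) x∈p = x∈p∪q⁺ (inj₁ x∈p)
∈-⋃⁺ (there p∈)  x∈p = x∈p∪q⁺ (inj₂ (∈-⋃⁺ p∈ x∈p))

∈-⋃⁻ : ∀ {n k} {x : Fin n} (ps : Vec (Subset n) k) →
       x ∈ ⋃ (toList ps) → ∃[ i ] x ∈ lookup ps i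
∈-⋃⁻ []       x∈ = contradiction x∈ ∉⊥
∈-⋃⁻ (p ∷ ps) x∈ with x∈p∪q⁻ p _ x∈
... | inj₁ x∈p = zero , x∈p
... | inj₂ x∈ps with i , x∈pᵢ ← ∈-⋃⁻ ps x∈ps = suc i , x∈pᵢ

∈-tuples⁺ : ∀ {A : Set} {xs : List A} {k} {v : Vec A k} →
            All (List._∈ xs) v → v List.∈ tuples xs k
∈-tuples⁺ []        = here refl
∈-tuples⁺ (x∈ ∷ v∈) = ∈-cartesianProductWith⁺ _∷_ x∈ (∈-tuples⁺ v∈)

∈-tuples⁻ : ∀ {A : Set} {xs : List A} k {v : Vec A k} →
            v List.∈ tuples xs k → All (List._∈ xs) v
∈-tuples⁻ zero    {[]} _  = []
∈-tuples⁻ {xs = xs} (suc k) v∈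
  with _ , _ , x∈ , w∈ , refl ← ∈-cartesianProductWith⁻ _∷_ xs (tuples xs k) v∈
  = x∈ ∷ ∈-tuples⁻ k w∈

∈-subsets : ∀ {ℓ} (p : Subset ℓ) → p List.∈ subsets ℓ
∈-subsets p = ∈-tuples⁺ (VecAll.universal (λ { true → here refl ; false → there (here refl) }) p)

∈-partitions : ∀ {ℓ m} {𝓕 : Vec (Subset ℓ) m} → IsPartition 𝓕 → 𝓕 List.∈ partitions ℓ m
∈-partitions {𝓕 = 𝓕} = ∈-filter⁺ isPartition? (∈-tuples⁺ (VecAll.universal ∈-subsets 𝓕))

μᶠ≤μ : ∀ {ℓ m} (𝓕 : Vec (Subset ℓ) m) t → IsPartition 𝓕 → μᶠ 𝓕 t ≤ μ ℓ m t
μᶠ≤μ 𝓕 t 𝓕-part =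
  v≤max⁺ 0 _ (inj₂ (ListAny.map⁺ (lose (∈-partitions 𝓕-part) ≤-refl)))

-- The condition `b ≤ ℓ` handles the initial value of `min`.
≤μᶠ : ∀ {ℓ m b} (𝓕 : Vec (Subset ℓ) m) t → b ≤ ℓ →
      (∀ (B : Vec (Subset ℓ) t) → All (_∈ᵛ 𝓕) B → b ≤ ∣ ∁ (⋃ (toList B)) ∣) → b ≤ μᶠ 𝓕 t
≤μᶠ 𝓕 t b≤ℓ b≤ = v≤min⁺ b≤ℓ (ListAll.map⁺ (ListAll.tabulate λ {B} B∈ →
  b≤ B (VecAll.map ∈-toList⁻ (∈-tuples⁻ t B∈))))

-- Identifying nodes by contracting edges.

merge : ∀ {k} (a b : Fin k) → ∃[ k′ ] Σ[ h ∈ (Fin k → Fin k′) ]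
        StrictlySurjective _≡_ h × h a ≡ h b × k ≤ suc k′
merge {k} a b with b ≟ a
... | yes refl = k , id , (λ y → y , refl) , refl , n≤1+n _
merge {suc k} a b | no b≢a = k , h , surj , ha≡hb , ≤-refl
  where
  h : Fin (suc k) → Fin k
  h x with b ≟ x
  -- `b` goes where `a` goes; every other point is renumbered by skipping `b`.
  ... | yes _  = punchOut b≢a
  ... | no b≢x = punchOut b≢x

  surj : StrictlySurjective _≡_ h
  surj y = punchIn b y , eq
    where
    eq : h (punchIn b y) ≡ y
    eq with b ≟ punchIn b y
    ... | yes b≡ = contradiction (sym b≡) (punchInᵢ≢i b y)
    ... | no _   = trans (punchOut-cong b refl) (punchOut-punchIn b)

  ha≡hb : h a ≡ h b
  ha≡hb with b ≟ a | b ≟ b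
  ... | yes b≡a | _      = contradiction b≡a b≢a
  ... | no _    | no b≢b = contradiction refl b≢b
  ... | no _    | yes _  = punchOut-cong b refl

-- Induction along `K`: each selected edge merges the classes of its two ends, which costs at most
-- one class.
contract : ∀ {n ℓ} (ends : Fin ℓ → Fin n × Fin n) (K : Subset ℓ) →
           ∃[ k ] Σ[ f ∈ (Fin n → Fin k) ] StrictlySurjective _≡_ f
           × (∀ {e} → e ∈ K → f (proj₁ (ends e)) ≡ f (proj₂ (ends e)))
           × n ≤ ∣ K ∣ + k
contract {n} ends [] = n , id , (λ y → y , refl) , (λ ()) , ≤-refl
contract ends (outside ∷ K) =
  let k , f , surj , glued , n≤ = contract (ends ∘ suc) K
  in k , f , surj , (λ { (there e∈K) → glued e∈K }) , n≤
contract ends (inside ∷ K) =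
  let k , f , f-surj , glued , n≤ = contract (ends ∘ suc) K
      k′ , h , h-surj , merged , k≤ =
        merge (f (proj₁ (ends zero))) (f (proj₂ (ends zero)))
  in k′ , h ∘ f
   , (λ z → let y , hy≡z = h-surj z ; x , fx≡y = f-surj y
            in x , trans (cong h fx≡y) hy≡z)
   , (λ { here → merged ; (there e∈K) → cong h (glued e∈K) })
   , ≤-trans n≤ (≤-trans (+-monoʳ-≤ ∣ K ∣ k≤) (≤-reflexive (+-suc ∣ K ∣ k′)))

surjective-constant⇒≤1 : ∀ {n k} {f : Fin n → Fin k} → StrictlySurjective _≡_ f →
                         (∀ x y → f x ≡ f y) → k ≤ 1
-- Any two elements of `Fin k` are values of `f`, hence equal, so even the constant map into `Fin 1`
-- is injective.
surjective-constant⇒≤1 surj const = injective⇒≤ {f = λ _ → zero} λ {a} {b} _ →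
  let x , fx≡a = surj a ; y , fy≡b = surj b
  in trans (sym fx≡a) (trans (const x y) fy≡b)

-- Walks, incidence and color classes.

module _ {n ℓ m} (G : ColoredEdgeGraph n ℓ m) where
  open ColoredEdgeGraph G

  Glues : ∀ {k} → (Fin n → Fin k) → Fin ℓ → Set
  Glues f e = f (proj₁ (ends e)) ≡ f (proj₂ (ends e))

  joins-glued : ∀ {k} (f : Fin n → Fin k) {e u v} → Joins e u v → Glues f e → f u ≡ f v
  joins-glued f (inj₁ eq) glued rewrite eq = glued
  joins-glued f (inj₂ eq) glued rewrite eq = sym glued

  walk-glued : ∀ {k} (f : Fin n → Fin k) {u v} (p : Walk u v) →
               ListAll.All (Glues f) (edges p) → f u ≡ f v
  walk-glued f stop         ListAll.[]                 = refl
  walk-glued f (step _ j p) (glued ListAll.∷ glued-p) =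
    trans (joins-glued f j glued) (walk-glued f p glued-p)

  -- Sides are indexed by `Fin 2` so that a half-edge, a side together with an edge, can be coded in
  -- `Fin (2 * ℓ)`.
  end : Fin 2 → Fin ℓ → Fin n
  end zero       e = proj₁ (ends e)
  end (suc zero) e = proj₂ (ends e)

  Incident : Fin n → Fin ℓ → Set
  Incident v e = ∃[ s ] end s e ≡ v

  joins⇒incident : ∀ {e u v} → Joins e u v → Incident u e
  joins⇒incident (inj₁ eq) = zero , cong proj₁ eq
  joins⇒incident (inj₂ eq) = suc zero , cong proj₂ eq

  -- The first edge of the path serves; it exists because the end nodes differ.
  exit : ∀ {S u v} → u ≢ v → Σ[ p ∈ Path u v ] Avoids S p →
         ∃[ e ] Incident u e × color e ∉ S
  exit u≢v ((stop , _)       , _)                 = contradiction refl u≢v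
  exit u≢v ((step e j p , _) , (e∉S ListAll.∷ _)) = e , joins⇒incident j , e∉S

  another-node : Fin ℓ → ∀ v → ∃[ w ] v ≢ w
  another-node e v with v ≟ proj₁ (ends e)
  ... | yes refl = proj₂ (ends e) , loopless (inj₁ refl)
  ... | no v≢    = proj₁ (ends e) , v≢

  colorClass : Fin m → Subset ℓ
  colorClass c = tabulate (λ e → does (color e ≟ c))

  ∈-colorClass⁺ : ∀ e → e ∈ colorClass (color e)
  ∈-colorClass⁺ e = lookup⇒[]= e _
    (trans (lookup∘tabulate _ e) (dec-true (color e ≟ color e) refl))

  ∈-colorClass⁻ : ∀ {e} c → e ∈ colorClass c → color e ≡ c
  ∈-colorClass⁻ {e} c e∈
    with color e ≟ c | trans (sym (lookup∘tabulate (λ e → does (color e ≟ c)) e)) ([]=⇒lookup e∈)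
  ... | yes eq | _ = eq

  colorClasses : Vec (Subset ℓ) m
  colorClasses = tabulate colorClass

  colorClasses-isPartition : IsPartition colorClasses
  colorClasses-isPartition =
      AllPairs.tabulate⁺ (λ {c} {d} c≢d classes≡ →
        -- As `color` is onto, the class of `c` contains an edge `e`; if the classes were equal, `e`
        -- would have both colors.
        let e , onto = colorOnto c
            e∈d = subst (e ∈_) classes≡ (subst (λ x → e ∈ colorClass x) (onto refl) (∈-colorClass⁺ e))
        in c≢d (trans (sym (onto refl)) (∈-colorClass⁻ d e∈d)))
    , AllPairs.tabulate⁺ (λ {c} {d} c≢d → ⊆-antisym
        (λ e∈ → let e∈c , e∈d = x∈p∩q⁻ (colorClass c) (colorClass d) e∈
                in contradiction (trans (sym (∈-colorClass⁻ c e∈c)) (∈-colorClass⁻ d e∈d)) c≢d)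
        ⊥⊆)
    , ⊆-antisym ⊆⊤ (λ {e} _ →
        ∈-⋃⁺ (∈-toList⁺ (∈-tabulate⁺ colorClass (color e))) (∈-colorClass⁺ e))

  ∈-colorClasses⁻ : ∀ {p} → p ∈ᵛ colorClasses → ∃[ c ] p ≡ colorClass c
  ∈-colorClasses⁻ = VecAny.tabulate⁻

  -- Consequences of connectedness: remaining edges and degrees.

  module _ {t} (t≤m : t ≤ m) (conn : Connected₊₁ t G) where

    -- Contracting `K` contracts every path that avoids `S`. So all nodes are identified, at most
    -- one class is left, and `n` is at most `∣ K ∣ + 1`.
    remaining-edges : ∀ {S} (K : Subset ℓ) → ∣ S ∣ ≡ t →
                      (∀ {e} → color e ∉ S → e ∈ K) → n ∸ 1 ≤ ∣ K ∣
    remaining-edges {S} K ∣S∣≡t ∉S⇒∈K with k , f , surj , glued , n≤ ← contract ends K =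
      m≤n+o⇒m∸n≤o n 1 (≤-trans n≤ (≤-trans
        (+-monoʳ-≤ ∣ K ∣ (surjective-constant⇒≤1 surj constant))
        (≤-reflexive (+-comm ∣ K ∣ 1))))
      where
      constant : ∀ u v → f u ≡ f v
      constant u v with u ≟ v
      ... | yes u≡v = cong f u≡v
      ... | no u≢v with (p , _) , avoids ← conn u v u≢v S ∣S∣≡t =
        walk-glued f p (ListAll.map (glued ∘ ∉S⇒∈K) avoids)

    μ-bound : n ∸ 1 ≤ μ ℓ m t
    μ-bound = ≤-trans (≤μᶠ colorClasses t n∸1≤ℓ n∸1≤∁)
                      (μᶠ≤μ colorClasses t colorClasses-isPartition)
      where
      n∸1≤∁ : ∀ (B : Vec (Subset ℓ) t) → All (_∈ᵛ colorClasses) B →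
              n ∸ 1 ≤ ∣ ∁ (⋃ (toList B)) ∣
      n∸1≤∁ B B∈ =
        let classOf : ∀ i → ∃[ c ] lookup B i ≡ colorClass c
            classOf i = ∈-colorClasses⁻ (VecAll.lookup⁺ B∈ i)
            -- The chosen classes may repeat, so their colors are padded to exactly `t`. An edge
            -- with color outside `S` lies in no chosen class.
            S , ∣S∣≡t , c∈S = cover (proj₁ ∘ classOf) ≤-refl t≤m
        in remaining-edges {S} _ ∣S∣≡t λ {e} e∉S → x∉p⇒x∈∁p λ e∈⋃B →
             let i , e∈Bᵢ = ∈-⋃⁻ B e∈⋃B
                 c , Bᵢ≡ = classOf i
             in e∉S (subst (_∈ S) (sym (∈-colorClass⁻ c (subst (e ∈_) Bᵢ≡ e∈Bᵢ))) (c∈S i))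

      n∸1≤ℓ : n ∸ 1 ≤ ℓ
      -- Any `t` colors will do, so the empty family is padded.
      n∸1≤ℓ with S , ∣S∣≡t , _ ← cover {0} (λ ()) z≤n t≤m =
        ≤-trans (remaining-edges {S} ⊤ ∣S∣≡t (λ _ → ∈⊤)) (∣p∣≤n {ℓ} ⊤)

    -- Witnesses that `v` has degree at least `k`. The incidence data also record on which side of
    -- each edge `v` lies.
    Star : Fin n → ℕ → Set
    Star v k = Σ[ f ∈ (Fin k → Fin ℓ) ] Injective _≡_ _≡_ f × (∀ i → Incident v (f i))

    star : Fin ℓ → ∀ v k → k ≤ suc t → Star v k
    star e₀ v zero    _      = (λ ()) , (λ { {()} }) , (λ ())
    star e₀ v (suc k) 1+k≤1+t =
      let f , f-inj , f-inc = star e₀ v k (≤-trans (n≤1+n _) 1+k≤1+t)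
          -- The `k` edges found so far number at most `t`, so their colors fit into `S`; an edge
          -- with color outside `S` is new.
          S , ∣S∣≡t , f∈S = cover (color ∘ f) (s≤s⁻¹ 1+k≤1+t) t≤m
          w , v≢w = another-node e₀ v
          e , e-inc , e∉S = exit v≢w (conn v w v≢w S ∣S∣≡t)
          e≢f : ∀ i → e ≢ f i
          e≢f i e≡fᵢ = e∉S (subst (λ x → color x ∈ S) (sym e≡fᵢ) (f∈S i))
          g : Fin (suc k) → Fin ℓ
          g = λ { zero → e ; (suc i) → f i }
          g-inj : Injective _≡_ _≡_ g
          g-inj = λ { {zero}  {zero}  _  → refl
                    ; {zero}  {suc j} eq → contradiction eq (e≢f j)
                    ; {suc i} {zero}  eq → contradiction (sym eq) (e≢f i)
                    ; {suc i} {suc j} eq → cong suc (f-inj eq) }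
      in g , g-inj , λ { zero → e-inc ; (suc i) → f-inc i }

    -- Every node selects `t + 1` half-edges, and no half-edge is selected twice. The given edge
    -- ensures that there is a second node to connect to.
    degree-bound : Fin ℓ → (t + 1) * n ≤ 2 * ℓ
    degree-bound e₀ = injective⇒≤ {f = uncurry halfEdge ∘ remQuot n} λ {x} {y} eq →
      trans (sym (combine-remQuot {t + 1} n x))
        (trans (cong (uncurry combine) (halfEdge-injective eq)) (combine-remQuot {t + 1} n y))
      where
      stars : ∀ v → Star v (t + 1)
      stars v = star e₀ v (t + 1) (≤-reflexive (+-comm t 1))

      edge : Fin (t + 1) → Fin n → Fin ℓ
      edge i v = proj₁ (stars v) i

      side : Fin (t + 1) → Fin n → Fin 2
      side i v = proj₁ (proj₂ (proj₂ (stars v)) i)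

      end-side-edge : ∀ i v → end (side i v) (edge i v) ≡ v
      end-side-edge i v = proj₂ (proj₂ (proj₂ (stars v)) i)

      halfEdge : Fin (t + 1) → Fin n → Fin (2 * ℓ)
      halfEdge i v = combine (side i v) (edge i v)

      halfEdge-injective : ∀ {p q : Fin (t + 1) × Fin n} →
                           uncurry halfEdge p ≡ uncurry halfEdge q → p ≡ q
      halfEdge-injective {i , v} {j , w} eq
        with side≡ , edge≡ ← combine-injective (side i v) (edge i v) (side j w) (edge j w) eq
        -- A half-edge determines the node at its end, so the two nodes agree and injectivity of one
        -- star finishes.
        with refl ← trans (sym (end-side-edge i v))
                      (trans (cong₂ end side≡ edge≡) (end-side-edge j w))
        = cong (_, v) (proj₁ (proj₂ (stars v)) edge≡)

theorem4p4 : (ℓ m t n : ℕ) → .{{_ : NonZero ℓ}} → .{{_ : NonZero m}} → .{{_ : NonZero t}} →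
    t ≤ m →
    Σ[ G ∈ ColoredEdgeGraph n ℓ m ] Connected₊₁ t G →
    (μ ℓ m t ≥ n ∸ 1) × (2 * ℓ ≥ (t + 1) * n)
theorem4p4 (suc ℓ) m t n t≤m (G , conn) = μ-bound G t≤m conn , degree-bound G t≤m conn zero
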